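{- Let $G$ be a connected graph. Then there is a homeomorphism $\Theta_E(G)\cong\mathcal D_E(G)$ between the edge-tangle space of $G$ and the edge-direction space of $G$.
   Context: Graphs are simple and undirected, possibly infinite. For a finite set $F\subset E(G)$ of edges, let $\mathcal S^E_F$ be the set of infinite connected components of $G\setminus F$ (the graph obtained by deleting the edges in $F$). For finite $F\subset F'\subset E(G)$, each member of $\mathcal S^E_{F'}$ is contained in a unique member of $\mathcal S^E_F$; this defines a map $\varepsilon_{F,F'}:\mathcal S^E_{F'}\to\mathcal S^E_F$. Edge-directions: $\mathcal D_E(G)$ is the inverse limit $\varprojlim_F\mathcal S^E_F$ over finite $F\subset E(G)$ ordered by inclusion, each $\mathcal S^E_F$ discrete, with transition maps $\varepsilon_{F,F'}$, taken with the subspace topology of the product. Equivalently, its elements are functions $\rho$ choosing $\rho(F)\in\mathcal S^E_F$ with $\rho(F')\subset\rho(F)$ whenever $F\subset F'$. Edge-tangles: $\Theta_E(G)$ is the inverse limit, over finite $F\subset E(G)$ ordered by inclusion, of the spaces $\mathrm{Ult}(2^{\mathcal S^E_F})$ of ultrafilters on the set $\mathcal S^E_F$ with the Stone topology (basic open sets $\{u : \mathcal A\in u\}$, $\mathcal A\subset\mathcal S^E_F$), with transition maps sending $u\in\mathrm{Ult}(2^{\mathcal S^E_{F'}})$ to its pushforward $\{\mathcal A\subset\mathcal S^E_F : \varepsilon_{F,F'}^{ -1}(\mathcal A)\in u\}$. If $\mathcal S^E_F=\emptyset$ there are no ultrafilters on it. -}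

module Defs where

open import Level using (Level; _⊔_; suc; 0ℓ)
open import Data.Empty.Polymorphic using (⊥)
open import Data.List.Base using (List; []; _∷_; _++_)
open import Data.List.Membership.Propositional using () renaming (_∈_ to _∈ₗ_)
import Data.List.Membership.Setoid as SetoidMembership
open import Data.List.Membership.Setoid.Properties using (∈-resp-≈)
import Data.List.Relation.Binary.Subset.Setoid as SetoidSubset
open import Data.List.Relation.Unary.All as All using (All; []; _∷_)
open import Data.List.Relation.Unary.All.Properties using (++⁺; ++⁻ˡ; ++⁻ʳ)
open import Data.Product.Base using (Σ; ∃; _×_; _,_; proj₁; proj₂)
open import Data.Sum.Base using (_⊎_; inj₁; inj₂)
open import Data.Unit.Polymorphic using (⊤; tt)
open import Function.Base using (_∘_; id)
open import Function.Bundles using (Func; Inverse; _⟶ₛ_)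
open import Relation.Binary.Bundles using (Setoid)
open import Relation.Binary.Core using (Rel)
open import Relation.Binary.Construct.Closure.ReflexiveTransitive as Star
  using (Star; ε; _◅◅_)
open import Relation.Binary.Definitions using (Irreflexive; Symmetric; _Respects_)
open import Relation.Binary.PropositionalEquality using (_≡_; refl; sym; trans)
open import Relation.Nullary.Negation using (¬_)
open import Relation.Unary using (Pred; _∈_; _⊆_; _≐_; _∩_; ∁)
open import Relation.Unary.Properties using (≐-refl; ≐-sym; ≐-trans)

private
  variable
    a c e o c₁ e₁ o₁ c₂ e₂ o₂ i r p s ℓ : Level

------------------------------------------------------------------------
-- Topological spaces
--
-- The points form a setoid and subsets of the space are predicates at the
-- level c of its points.  In open-⋃ the union of the family is given as a
-- predicate W at level c having the same points, since the literal union
-- lives at a higher level.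

record Space (c e o : Level) : Set (suc (suc c ⊔ e ⊔ o)) where
  field
    setoid : Setoid c e
  open Setoid setoid public using (Carrier; _≈_)
  field
    IsOpen    : Pred (Pred Carrier c) o
    open-resp : ∀ {U} → IsOpen U → U Respects _≈_
    open-all  : IsOpen (λ _ → ⊤)
    open-∩    : ∀ {U V} → IsOpen U → IsOpen V → IsOpen (U ∩ V)
    open-⋃    : ∀ (𝒰 : Pred (Pred Carrier c) (suc c ⊔ o)) →
                (∀ {U} → U ∈ 𝒰 → IsOpen U) →
                ∀ {W} → W ≐ (λ x → ∃ λ U → U ∈ 𝒰 × x ∈ U) → IsOpen W

Continuous : (X : Space c e₁ o₁) (Y : Space c e₂ o₂) →
             (Space.Carrier X → Space.Carrier Y) → Set (suc c ⊔ o₁ ⊔ o₂)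
Continuous X Y f =
  ∀ V → Space.IsOpen Y V → Space.IsOpen X (λ x → f x ∈ V)

record Homeomorphism (X : Space c e₁ o₁) (Y : Space c e₂ o₂) :
                     Set (suc c ⊔ e₁ ⊔ e₂ ⊔ o₁ ⊔ o₂) where
  field
    inverse : Inverse (Space.setoid X) (Space.setoid Y)
  open Inverse inverse public using (to; from)
  field
    to-continuous   : Continuous X Y to
    from-continuous : Continuous Y X from

discrete : Setoid c e → Space c e (c ⊔ e)
discrete S = record
  { setoid    = S
  ; IsOpen    = λ U → U Respects _≈_
  ; open-resp = id
  ; open-all  = λ _ _ → tt
  ; open-∩    = λ u v x≈y (x∈U , x∈V) → u x≈y x∈U , v x≈y x∈V
  ; open-⋃    = λ 𝒰 open-𝒰 (W⊆ , ⊆W) x≈y x∈W →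
      let U , U∈𝒰 , x∈U = W⊆ x∈W in ⊆W (U , U∈𝒰 , open-𝒰 U∈𝒰 x≈y x∈U)
  }
  where open Setoid S using (_≈_)

⋂ : {A : Set a} → List (Pred A p) → Pred A (a ⊔ suc p)
⋂ {a = a} Bs x = All (λ B → Lift′ (x ∈ B)) Bs
  where
  Lift′ : Set ℓ → Set ℓ
  Lift′ = id

-- The topology having the sets in 𝓑 as a subbasis.

generated : (S : Setoid c e) (𝓑 : Pred (Pred (Setoid.Carrier S) c) s) →
            (∀ {B} → B ∈ 𝓑 → B Respects Setoid._≈_ S) →
            Space c e (suc c ⊔ s)
generated S 𝓑 𝓑-resp = record
  { setoid    = S
  ; IsOpen    = λ U → ∀ {x} → x ∈ U → ∃ λ Bs → All 𝓑 Bs × x ∈ ⋂ Bs × ⋂ Bs ⊆ U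
  ; open-resp = λ u x≈y x∈U →
      let Bs , Bs∈𝓑 , x∈⋂ , ⋂⊆U = u x∈U in
      ⋂⊆U (All.zipWith (λ (B∈𝓑 , x∈B) → 𝓑-resp B∈𝓑 x≈y x∈B) (Bs∈𝓑 , x∈⋂))
  ; open-all  = λ _ → [] , [] , [] , λ _ → tt
  ; open-∩    = λ u v (x∈U , x∈V) →
      let Bs , Bs∈𝓑 , x∈⋂Bs , ⋂Bs⊆U = u x∈U
          Cs , Cs∈𝓑 , x∈⋂Cs , ⋂Cs⊆V = v x∈V in
      Bs ++ Cs , ++⁺ Bs∈𝓑 Cs∈𝓑 , ++⁺ x∈⋂Bs x∈⋂Cs ,
      λ y∈⋂ → ⋂Bs⊆U (++⁻ˡ Bs y∈⋂) , ⋂Cs⊆V (++⁻ʳ Bs y∈⋂)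
  ; open-⋃    = λ 𝒰 open-𝒰 (W⊆ , ⊆W) x∈W →
      let U , U∈𝒰 , x∈U = W⊆ x∈W
          Bs , Bs∈𝓑 , x∈⋂ , ⋂⊆U = open-𝒰 U∈𝒰 x∈U in
      Bs , Bs∈𝓑 , x∈⋂ , λ y∈⋂ → ⊆W (U , U∈𝒰 , ⋂⊆U y∈⋂)
  }

-- The coarsest topology making all the maps f k continuous.

initial : {I : Set i} (S : Setoid c e) (Y : I → Space c₁ e₁ o₁) →
          (∀ k → S ⟶ₛ Space.setoid (Y k)) →
          Space c e (suc c ⊔ i ⊔ suc c₁ ⊔ o₁)
initial {I = I} S Y f = generated S
  (λ B → Σ I λ k → ∃ λ V → Space.IsOpen (Y k) V × B ≐ (λ x → Func.to (f k) x ∈ V))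
  (λ (k , V , v , B⊆ , ⊆B) x≈y x∈B →
    ⊆B (Space.open-resp (Y k) v (Func.cong (f k) x≈y) (B⊆ x∈B)))

product : {I : Set i} → (I → Space c e o) → Space (i ⊔ c) (i ⊔ e) (suc i ⊔ suc c ⊔ o)
product {I = I} X = initial
  (record
    { Carrier       = ∀ k → Space.Carrier (X k)
    ; _≈_           = λ x y → ∀ k → Space._≈_ (X k) (x k) (y k)
    ; isEquivalence = record
      { refl  = λ k → Setoid.refl (Space.setoid (X k))
      ; sym   = λ x≈y k → Setoid.sym (Space.setoid (X k)) (x≈y k)
      ; trans = λ x≈y y≈z k → Setoid.trans (Space.setoid (X k)) (x≈y k) (y≈z k)
      }
    })
  X
  (λ k → record { to = λ x → x k ; cong = λ x≈y → x≈y k })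

subspace : (X : Space c e o) → Pred (Space.Carrier X) p →
           Space (c ⊔ p) e (suc c ⊔ suc p ⊔ o)
subspace X P = initial {I = ⊤ {0ℓ}}
  (record
    { Carrier       = Σ (Space.Carrier X) P
    ; _≈_           = λ x y → Space._≈_ X (proj₁ x) (proj₁ y)
    ; isEquivalence = record
      { refl  = Setoid.refl (Space.setoid X)
      ; sym   = Setoid.sym (Space.setoid X)
      ; trans = Setoid.trans (Space.setoid X)
      }
    })
  (λ _ → X)
  (λ _ → record { to = proj₁ ; cong = id })

inverseLimit : {I : Set i} (_≤_ : Rel I r) (X : I → Space c e o) →
               (∀ j k → j ≤ k → Space.setoid (X k) ⟶ₛ Space.setoid (X j)) →
               Space (i ⊔ r ⊔ c ⊔ e) (i ⊔ e) (suc i ⊔ suc r ⊔ suc c ⊔ suc e ⊔ o)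
inverseLimit _≤_ X f = subspace (product X)
  (λ x → ∀ j k (j≤k : j ≤ k) → Space._≈_ (X j) (Func.to (f j k j≤k) (x k)) (x j))

------------------------------------------------------------------------
-- Ultrafilters

-- Subsets are taken at the level of the equality of S, so that singletons
-- are subsets.  Under excluded middle at all levels every predicate is
-- equivalent to one at any given level, so no subset is lost.

record Subset (S : Setoid c e) : Set (c ⊔ suc e) where
  constructor subset
  open Setoid S using (Carrier; _≈_)
  field
    mem  : Pred Carrier e
    resp : mem Respects _≈_

open Subset public

module _ {S : Setoid c e} where
  open Setoid S using () renaming (sym to ≈-sym)

  full empty : Subset S
  full  = subset (λ _ → ⊤) (λ _ _ → tt)
  empty = subset (λ _ → ⊥) (λ _ ())

  infixr 7 _∩ₛ_
  _∩ₛ_ : Subset S → Subset S → Subset S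
  A ∩ₛ B = subset (mem A ∩ mem B)
                  (λ x≈y (x∈A , x∈B) → resp A x≈y x∈A , resp B x≈y x∈B)

  ∁ₛ : Subset S → Subset S
  ∁ₛ A = subset (∁ (mem A)) (λ x≈y x∉A y∈A → x∉A (resp A (≈-sym x≈y) y∈A))

preimage : {S : Setoid c₁ e} {T : Setoid c₂ e} → S ⟶ₛ T → Subset T → Subset S
preimage f A = subset (λ x → Func.to f x ∈ mem A) (resp A ∘ Func.cong f)

record Ultrafilter (S : Setoid c e) : Set (c ⊔ suc e) where
  field
    sets        : Pred (Subset S) e
    full∈       : full ∈ sets
    empty∉      : ¬ (empty ∈ sets)
    upward      : ∀ {A B} → mem A ⊆ mem B → A ∈ sets → B ∈ sets
    ∩-closed    : ∀ {A B} → A ∈ sets → B ∈ sets → A ∩ₛ B ∈ sets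
    ultra       : ∀ A → A ∈ sets ⊎ ∁ₛ A ∈ sets

open Ultrafilter public using (sets)

ultrafilterSetoid : Setoid c e → Setoid (c ⊔ suc e) (c ⊔ suc e)
ultrafilterSetoid S = record
  { Carrier       = Ultrafilter S
  ; _≈_           = λ u v → sets u ≐ sets v
  ; isEquivalence = record { refl = ≐-refl ; sym = ≐-sym ; trans = ≐-trans }
  }

Ult : (S : Setoid c e) → Space (c ⊔ suc e) (c ⊔ suc e) (suc c ⊔ suc (suc e))
Ult S = generated (ultrafilterSetoid S)
  (λ B → ∃ λ (A : Subset S) → B ≐ (λ u → A ∈ sets u))
  (λ (A , B⊆ , ⊆B) (u⊆v , _) u∈B → ⊆B (u⊆v (B⊆ u∈B)))

pushforward : {S : Setoid c₁ e} {T : Setoid c₂ e} → S ⟶ₛ T →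
              ultrafilterSetoid S ⟶ₛ ultrafilterSetoid T
pushforward f = record
  { to   = λ u → let open Ultrafilter u in record
    { sets     = λ A → preimage f A ∈ sets u
    ; full∈    = full∈
    ; empty∉   = empty∉
    ; upward   = λ A⊆B → upward A⊆B
    ; ∩-closed = ∩-closed
    ; ultra    = λ A → ultra (preimage f A)
    }
  ; cong = λ (u⊆v , v⊆u) → u⊆v , v⊆u
  }

------------------------------------------------------------------------
-- Graphs

record Graph (ℓ : Level) : Set (suc ℓ) where
  field
    V         : Set ℓ
    Adj       : Rel V ℓ
    symmetric : Symmetric Adj
    loopless  : Irreflexive _≡_ Adj

open Graph public using (V; Adj)

Reachable : (G : Graph ℓ) → Rel (V G) ℓ
Reachable G = Star (Adj G)

-- The empty graph counts as connected.

Connected : Graph ℓ → Set ℓ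
Connected G = ∀ u v → Reachable G u v

Infinite : {A : Set a} → Pred A p → Set (a ⊔ p)
Infinite {A = A} P = ¬ ∃ λ (xs : List A) → P ⊆ (_∈ₗ xs)

-- A component is represented by its vertex set.

IsComponent : (G : Graph ℓ) → Pred (V G) ℓ → Set ℓ
IsComponent G C = ∃ λ v → C ≐ Reachable G v

record InfiniteComponent (G : Graph ℓ) : Set (suc ℓ) where
  field
    vertices    : Pred (V G) ℓ
    isComponent : IsComponent G vertices
    infinite    : Infinite vertices

open InfiniteComponent public

infiniteComponents : Graph ℓ → Setoid (suc ℓ) ℓ
infiniteComponents G = record
  { Carrier       = InfiniteComponent G
  ; _≈_           = λ C D → vertices C ≐ vertices D
  ; isEquivalence = record { refl = ≐-refl ; sym = ≐-sym ; trans = ≐-trans }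
  }

record Edge (G : Graph ℓ) : Set ℓ where
  constructor edge
  field
    {src tgt} : V G
    adjacent  : Adj G src tgt

open Edge public

-- Edges are unordered pairs of vertices.

edgeSetoid : Graph ℓ → Setoid ℓ ℓ
edgeSetoid G = record
  { Carrier       = Edge G
  ; _≈_           = λ f g → (src f ≡ src g × tgt f ≡ tgt g)
                          ⊎ (src f ≡ tgt g × tgt f ≡ src g)
  ; isEquivalence = record
    { refl  = inj₁ (refl , refl)
    ; sym   = λ where
        (inj₁ (p , q)) → inj₁ (sym p , sym q)
        (inj₂ (p , q)) → inj₂ (sym q , sym p)
    ; trans = λ where
        (inj₁ (p , q)) (inj₁ (p′ , q′)) → inj₁ (trans p p′ , trans q q′)
        (inj₁ (p , q)) (inj₂ (p′ , q′)) → inj₂ (trans p p′ , trans q q′)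
        (inj₂ (p , q)) (inj₁ (p′ , q′)) → inj₂ (trans p q′ , trans q p′)
        (inj₂ (p , q)) (inj₂ (p′ , q′)) → inj₁ (trans p q′ , trans q p′)
    }
  }

-- Finite edge sets are lists, preordered by inclusion.  Lists with the same
-- elements include each other, so families compatible along this preorder
-- do not distinguish them.

FiniteEdgeSet : Graph ℓ → Set ℓ
FiniteEdgeSet G = List (Edge G)

module _ {G : Graph ℓ} where
  open SetoidMembership (edgeSetoid G) public using () renaming (_∉_ to _∉ᴱ_)
  open SetoidSubset (edgeSetoid G) public using () renaming (_⊆_ to _⊆ᴱ_)

infixl 6 _∖_
_∖_ : (G : Graph ℓ) → FiniteEdgeSet G → Graph ℓ
G ∖ F = record
  { V         = V G
  ; Adj       = λ u v → Σ (Adj G u v) λ uv → edge uv ∉ᴱ F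
  ; symmetric = λ (uv , uv∉F) →
      Graph.symmetric G uv ,
      λ vu∈F → uv∉F (∈-resp-≈ (edgeSetoid G)
        {x = edge (Graph.symmetric G uv)} {y = edge uv} (inj₂ (refl , refl)) vu∈F)
  ; loopless  = λ u≡v (uv , _) → Graph.loopless G u≡v uv
  }

𝒮ᴱ : (G : Graph ℓ) → FiniteEdgeSet G → Setoid (suc ℓ) ℓ
𝒮ᴱ G F = infiniteComponents (G ∖ F)

module _ (G : Graph ℓ) (F F′ : FiniteEdgeSet G) (F⊆F′ : F ⊆ᴱ F′) where

  reachable-mono : ∀ {u v} → Reachable (G ∖ F′) u v → Reachable (G ∖ F) u v
  reachable-mono = Star.map λ (uv , uv∉F′) → uv , λ uv∈F → uv∉F′ (F⊆F′ {edge uv} uv∈F)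

  private
    hull : InfiniteComponent (G ∖ F′) → Pred (V G) _
    hull C w = ∃ λ v → v ∈ vertices C × Reachable (G ∖ F) v w

    hull-⊇ : ∀ C → vertices C ⊆ hull C
    hull-⊇ C v∈C = _ , v∈C , ε

  transition : 𝒮ᴱ G F′ ⟶ₛ 𝒮ᴱ G F
  transition = record
    { to   = λ C → let r , C⊆ , ⊆C = isComponent C in record
      { vertices    = hull C
      ; isComponent = r , (λ (v , v∈C , v⇝w) → reachable-mono (C⊆ v∈C) ◅◅ v⇝w)
                        , (λ r⇝w → r , ⊆C ε , r⇝w)
      ; infinite    = λ (xs , hull⊆xs) →
          infinite C (xs , λ v∈C → hull⊆xs (hull-⊇ C v∈C))
      }
    ; cong = λ (C⊆D , D⊆C) → (λ (v , v∈C , v⇝w) → v , C⊆D v∈C , v⇝w)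
                           , (λ (v , v∈D , v⇝w) → v , D⊆C v∈D , v⇝w)
    }

  transition-⊇ : ∀ C → vertices C ⊆ vertices (Func.to transition C)
  transition-⊇ = hull-⊇

  transition-unique : ∀ C D → vertices C ⊆ vertices D →
                      Setoid._≈_ (𝒮ᴱ G F) D (Func.to transition C)
  transition-unique C D C⊆D =
    let r , _ , ⊆C = isComponent C
        _ , D⊆ , ⊆D = isComponent D
        r∈C = ⊆C ε
    in (λ w∈D → r , r∈C ,
          Star.reverse (Graph.symmetric (G ∖ F)) (D⊆ (C⊆D r∈C)) ◅◅ D⊆ w∈D)
     , (λ (v , v∈C , v⇝w) → ⊆D (D⊆ (C⊆D v∈C) ◅◅ v⇝w))

------------------------------------------------------------------------
-- Edge-directions and edge-tangles

𝒟ᴱ : (G : Graph ℓ) → Space (suc ℓ) ℓ (suc (suc ℓ))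
𝒟ᴱ G = inverseLimit _⊆ᴱ_ (λ F → discrete (𝒮ᴱ G F)) (transition G)

Θᴱ : (G : Graph ℓ) → Space (suc ℓ) (suc ℓ) (suc (suc ℓ))
Θᴱ G = inverseLimit _⊆ᴱ_ (λ F → Ult (𝒮ᴱ G F))
  (λ F F′ F⊆F′ → pushforward (transition G F F′ λ {x} → F⊆F′ {x}))

{-# OPTIONS --safe #-}

-- Since G is connected, every vertex is joined in G ∖ F to one of finitely many
-- vertices: a fixed vertex or an end of an edge in F, according to whether a path
-- to the fixed vertex avoids F or has a first edge in F.  Hence 𝒮ᴱ G F is finite,
-- its ultrafilters are principal, and sending an ultrafilter to its point is a
-- homeomorphism from Ult (𝒮ᴱ G F) to the discrete space 𝒮ᴱ G F, natural in F.

module Submission where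

open import Defs
open import Axiom.ExcludedMiddle using (ExcludedMiddle)

open import Data.Empty.Polymorphic using (⊥-elim)
open import Data.List.Base using (List; []; _∷_; _++_; map; foldr)
open import Data.List.Membership.Propositional using (find; lose)
  renaming (_∈_ to _∈ₗ_)
open import Data.List.Membership.Propositional.Properties
  using (∈-++⁺ˡ; ∈-++⁺ʳ; ∈-map⁺)
open import Data.List.Relation.Unary.All using (All; []; _∷_)
open import Data.List.Relation.Unary.Any using (Any; here; there)
open import Data.Product.Base using (∃; _×_; _,_; proj₁; proj₂)
open import Data.Sum.Base using (_⊎_; inj₁; inj₂)
open import Data.Unit.Polymorphic using (⊤; tt)
open import Function.Base using (_∘_; id)
open import Function.Bundles using (Func; _⟶ₛ_)
open import Level using (Level; Lift; lift; lower; 0ℓ; _⊔_; suc)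
open import Relation.Binary.Bundles using (Setoid)
open import Relation.Binary.Construct.Closure.ReflexiveTransitive as Star
  using (ε; _◅_; _◅◅_)
open import Relation.Binary.Core using (Rel)
open import Relation.Binary.Definitions using (_Respects_)
open import Relation.Binary.PropositionalEquality using (refl)
open import Relation.Nullary.Decidable using (yes; no)
open import Relation.Nullary.Negation using (contradiction)
open import Relation.Unary using (Pred; _∈_; _⊆_; _∩_)

private
  variable
    c e i o r s e₁ o₁ e₂ o₂ e₃ o₃ ℓ : Level

-- Continuity

-- The union is over all open subsets of `W`, so no neighbourhoods have to be chosen. This also
-- carries openness over to a pointwise equivalent predicate.
open-local : (X : Space c e o) {W : Pred (Space.Carrier X) c} →
             (∀ {x} → x ∈ W → ∃ λ U → Space.IsOpen X U × x ∈ U × U ⊆ W) →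
             Space.IsOpen X W
open-local {c = c} X {W} nbhd = Space.open-⋃ X
  (λ U → Lift (suc c) (Space.IsOpen X U × U ⊆ W)) (proj₁ ∘ lower)
  ( (λ x∈W → let U , open-U , x∈U , U⊆W = nbhd x∈W in U , lift (open-U , U⊆W) , x∈U)
  , (λ (_ , lift (_ , U⊆W) , x∈U) → U⊆W x∈U) )

∘-continuous : (X : Space c e₁ o₁) (Y : Space c e₂ o₂) (Z : Space c e₃ o₃)
               {f : Space.Carrier X → Space.Carrier Y}
               {g : Space.Carrier Y → Space.Carrier Z} →
               Continuous Y Z g → Continuous X Y f → Continuous X Z (g ∘ f)
∘-continuous X Y Z g-cont f-cont V open-V = f-cont _ (g-cont V open-V)

discrete-continuous : (S : Setoid c e) (Y : Space c e₁ o₁) (f : S ⟶ₛ Space.setoid Y) →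
                      Continuous (discrete S) Y (Func.to f)
discrete-continuous S Y f V open-V x≈y = Space.open-resp Y open-V (Func.cong f x≈y)

module _ (X : Space c e₁ o₁) (S : Setoid c e) {𝓑 : Pred (Pred (Setoid.Carrier S) c) s}
         (resp : ∀ {B} → B ∈ 𝓑 → B Respects Setoid._≈_ S)
         {g : Space.Carrier X → Setoid.Carrier S}
         (open-preimage : ∀ {B} → B ∈ 𝓑 → Space.IsOpen X (λ x → g x ∈ B))
  where

  private
    -- ⋂ Bs pulled back along g, but at level c, where open sets live.
    pullback : List (Pred (Setoid.Carrier S) c) → Pred (Space.Carrier X) c
    pullback = foldr (λ B U → (λ x → g x ∈ B) ∩ U) (λ _ → ⊤)

    pullback-open : ∀ {Bs} → All 𝓑 Bs → Space.IsOpen X (pullback Bs)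
    pullback-open []           = Space.open-all X
    pullback-open (B∈𝓑 ∷ Bs∈𝓑) = Space.open-∩ X (open-preimage B∈𝓑) (pullback-open Bs∈𝓑)

    ⋂⇒pullback : ∀ Bs {x} → g x ∈ ⋂ Bs → x ∈ pullback Bs
    ⋂⇒pullback []       []         = tt
    ⋂⇒pullback (B ∷ Bs) (gx∈B ∷ p) = gx∈B , ⋂⇒pullback Bs p

    pullback⇒⋂ : ∀ Bs {x} → x ∈ pullback Bs → g x ∈ ⋂ Bs
    pullback⇒⋂ []       _          = []
    pullback⇒⋂ (B ∷ Bs) (gx∈B , p) = gx∈B ∷ pullback⇒⋂ Bs p

  -- Continuity may be tested on a subbasis: a finite intersection of subbasic sets around `g x`
  -- inside `V` pulls back to a finite intersection of open sets around `x`.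
  generated-continuous : Continuous X (generated S 𝓑 resp) g
  generated-continuous V open-V = open-local X λ gx∈V →
    let Bs , Bs∈𝓑 , gx∈⋂ , ⋂⊆V = open-V gx∈V in
    pullback Bs , pullback-open Bs∈𝓑 , ⋂⇒pullback Bs gx∈⋂ , ⋂⊆V ∘ pullback⇒⋂ Bs

module _ {I : Set i} (S : Setoid c e) (Y : I → Space c e₁ o₁)
         (f : ∀ k → S ⟶ₛ Space.setoid (Y k))
  where

  initial-map-continuous : ∀ k → Continuous (initial S Y f) (Y k) (Func.to (f k))
  initial-map-continuous k V open-V fx∈V =
    (λ x → Func.to (f k) x ∈ V) ∷ [] , (k , V , open-V , id , id) ∷ [] ,
    fx∈V ∷ [] , λ { (fy∈V ∷ []) → fy∈V }

  initial-continuous : (X : Space c e₂ o₂) {g : Space.Carrier X → Setoid.Carrier S} →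
                       (∀ k → Continuous X (Y k) (Func.to (f k) ∘ g)) →
                       Continuous X (initial S Y f) g
  initial-continuous X fg-cont = generated-continuous X S
    (λ (k , V , open-V , B⊆ , ⊆B) x≈y x∈B →
      ⊆B (Space.open-resp (Y k) open-V (Func.cong (f k) x≈y) (B⊆ x∈B)))
    -- `B` is only pointwise equivalent to the preimage of `V` under `f k`, so openness is
    -- transferred by `open-local`.
    λ (k , V , open-V , B⊆ , ⊆B) → open-local X λ gx∈B →
      _ , fg-cont k V open-V , B⊆ gx∈B , ⊆B

-- `Continuous` relates spaces with points at one common level, so each `X k` is placed at the level
-- of the limit.
module _ {I : Set i} (_≤_ : Rel I r) (X : I → Space (i ⊔ r ⊔ c ⊔ e) e o)
         (f : ∀ j k → j ≤ k → Space.setoid (X k) ⟶ₛ Space.setoid (X j))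
  where

  private
    Lim = inverseLimit _≤_ X f

    coordinate : ∀ k → Space.setoid (product X) ⟶ₛ Space.setoid (X k)
    coordinate k = record { to = λ x → x k ; cong = λ x≈y → x≈y k }

    inclusion : ⊤ {0ℓ} → Space.setoid Lim ⟶ₛ Space.setoid (product X)
    inclusion _ = record { to = proj₁ ; cong = id }

  projection-continuous : ∀ k → Continuous Lim (X k) (λ x → proj₁ x k)
  projection-continuous k =
    ∘-continuous Lim (product X) (X k)
      (initial-map-continuous (Space.setoid (product X)) X coordinate k)
      (initial-map-continuous (Space.setoid Lim) (λ _ → product X) inclusion tt)

  inverseLimit-continuous : (Z : Space (i ⊔ r ⊔ c ⊔ e) e₁ o₁)
                            {g : Space.Carrier Z → Space.Carrier Lim} →
                            (∀ k → Continuous Z (X k) (λ z → proj₁ (g z) k)) →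
                            Continuous Z Lim g
  inverseLimit-continuous Z cont =
    initial-continuous (Space.setoid Lim) (λ _ → product X) inclusion Z λ _ →
    initial-continuous (Space.setoid (product X)) X coordinate Z cont

-- Ultrafilters on finite sets

Finite : Setoid c e → Set (c ⊔ e)
Finite S = ∃ λ xs → ∀ x → Any (Setoid._≈_ S x) xs

module _ (em : ∀ {a} → ExcludedMiddle a) (S : Setoid c e) where
  open Setoid S using (Carrier; _≈_) renaming (refl to ≈-refl; sym to ≈-sym; trans to ≈-trans)

  singleton : Carrier → Subset S
  singleton x = subset (_≈ x) (λ y≈z y≈x → ≈-trans (≈-sym y≈z) y≈x)

  principal : Carrier → Ultrafilter S
  principal x = record
    { sets     = λ A → x ∈ mem A
    ; full∈    = tt
    ; empty∉   = ⊥-elim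
    ; upward   = λ A⊆B → A⊆B
    ; ∩-closed = _,_
    ; ultra    = ∈-or-∈∁
    }
    where
    ∈-or-∈∁ : ∀ A → x ∈ mem A ⊎ x ∈ mem (∁ₛ A)
    ∈-or-∈∁ A with em {P = x ∈ mem A}
    ... | yes x∈A = inj₁ x∈A
    ... | no  x∉A = inj₂ x∉A

  principalFunc : S ⟶ₛ ultrafilterSetoid S
  principalFunc = record
    { to   = principal
    ; cong = λ x≈y → (λ {A} → resp A x≈y) , (λ {A} → resp A (≈-sym x≈y))
    }

  module _ (u : Ultrafilter S) where
    open Ultrafilter u hiding (sets)

    -- Induction on a list covering `A`: if `u` rejects the singleton of the head, it contains `A`
    -- without that point, which the tail covers. An exhausted list would put the empty set into
    -- `u`.
    singleton∈ : ∀ xs A → A ∈ sets u → (∀ {y} → y ∈ mem A → Any (y ≈_) xs) →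
                 ∃ λ x → singleton x ∈ sets u
    singleton∈ [] A A∈u A⊆[] =
      contradiction (upward {A} {empty} (λ y∈A → contradiction (A⊆[] y∈A) λ ()) A∈u) empty∉
    singleton∈ (x ∷ xs) A A∈u A⊆ with ultra (singleton x)
    ... | inj₁ x∈u = x , x∈u
    ... | inj₂ ∁x∈u = singleton∈ xs (A ∩ₛ ∁ₛ (singleton x)) (∩-closed A∈u ∁x∈u) A∖x⊆xs
      where
      A∖x⊆xs : ∀ {y} → y ∈ mem (A ∩ₛ ∁ₛ (singleton x)) → Any (y ≈_) xs
      A∖x⊆xs (y∈A , y≉x) with A⊆ y∈A
      ... | here y≈x   = contradiction y≈x y≉x
      ... | there y∈xs = y∈xs

    module _ {x} (x∈u : singleton x ∈ sets u) where

      -- If `x` were outside `A`, then `singleton x ∩ₛ A` would be an empty member of `u`.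
      sets⇒∋ : ∀ A → A ∈ sets u → x ∈ mem A
      sets⇒∋ A A∈u with em {P = x ∈ mem A}
      ... | yes x∈A = x∈A
      ... | no  x∉A = contradiction
        (upward {singleton x ∩ₛ A} {empty}
          (λ (y≈x , y∈A) → contradiction (resp A y≈x y∈A) x∉A) (∩-closed x∈u A∈u))
        empty∉

      ∋⇒sets : ∀ A → x ∈ mem A → A ∈ sets u
      ∋⇒sets A x∈A = upward {singleton x} {A} (λ y≈x → resp A (≈-sym y≈x) x∈A) x∈u

  module _ (finite : Finite S) where

    private
      point-singleton : ∀ u → ∃ λ x → singleton x ∈ sets u
      point-singleton u = let xs , all∈xs = finite in
        singleton∈ u xs full (Ultrafilter.full∈ u) (λ {y} _ → all∈xs y)

    point : Ultrafilter S → Carrier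
    point = proj₁ ∘ point-singleton

    point∈⁺ : ∀ u A → A ∈ sets u → point u ∈ mem A
    point∈⁺ u = sets⇒∋ u (proj₂ (point-singleton u))

    point∈⁻ : ∀ u A → point u ∈ mem A → A ∈ sets u
    point∈⁻ u = ∋⇒sets u (proj₂ (point-singleton u))

    -- Membership in `singleton x` unfolds to `_≈ x`; this turns equations between points into
    -- membership in ultrafilters.
    point-unique : ∀ u {x} → singleton x ∈ sets u → point u ≈ x
    point-unique u {x} = point∈⁺ u (singleton x)

    point-singleton∈ : ∀ u → singleton (point u) ∈ sets u
    point-singleton∈ u = point∈⁻ u (singleton (point u)) ≈-refl

module _ (em : ∀ {a} → ExcludedMiddle a) (S : Setoid (c ⊔ suc e) e) (finite : Finite S) where

  point-continuous : Continuous (Ult S) (discrete S) (point em S finite)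
  point-continuous V V-resp {u} pu∈V =
    -- The basic open set given by the singleton of `point u` lies in the fibre of `point` over that
    -- point. `Lift` raises it to the level of the points of `Ult S`.
    (λ v → Lift (c ⊔ suc e) (⟨pu⟩ ∈ sets v)) ∷ [] , (⟨pu⟩ , lower , lift) ∷ [] ,
    lift (point-singleton∈ em S finite u) ∷ [] ,
    λ { {v} (lift ⟨pu⟩∈v ∷ []) →
          V-resp (Setoid.sym S (point-unique em S finite v ⟨pu⟩∈v)) pu∈V }
    where
    ⟨pu⟩ = singleton em S (point em S finite u)

-- Inverse limits of ultrafilter spaces on finite sets

module _ (em : ∀ {a} → ExcludedMiddle a) {I : Set i} (_≤_ : Rel I r)
         (S : I → Setoid (i ⊔ r ⊔ c ⊔ suc e) e)
         (finite : ∀ k → Finite (S k))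
         (f : ∀ j k → j ≤ k → S k ⟶ₛ S j)
  where

  private
    pushforwards : ∀ j k → j ≤ k → Space.setoid (Ult (S k)) ⟶ₛ Space.setoid (Ult (S j))
    pushforwards j k j≤k = pushforward (f j k j≤k)

    UltLim = inverseLimit _≤_ (λ k → Ult (S k)) pushforwards
    DiscLim = inverseLimit _≤_ (λ k → discrete (S k)) f

    pt : ∀ k → Ultrafilter (S k) → Setoid.Carrier (S k)
    pt k = point em (S k) (finite k)

    pr : ∀ k → Setoid.Carrier (S k) → Ultrafilter (S k)
    pr k = principal em (S k)

    to : Space.Carrier UltLim → Space.Carrier DiscLim
    to (u , compatible) = (λ k → pt k (u k)) , λ j k j≤k →
      -- The singleton of the point of `u j` is in `u j`, so by compatibility its preimage is in
      -- `u k` and contains the point of `u k`.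
      point∈⁺ em (S k) (finite k) (u k)
        (preimage (f j k j≤k) (singleton em (S j) (pt j (u j))))
        (proj₂ (compatible j k j≤k) (point-singleton∈ em (S j) (finite j) (u j)))

    from : Space.Carrier DiscLim → Space.Carrier UltLim
    from (x , compatible) = (λ k → pr k (x k)) , λ j k j≤k →
      -- The pushforward of a principal ultrafilter has, by computation, the sets of the principal
      -- one at the image point.
      Func.cong (principalFunc em (S j)) (compatible j k j≤k)

  -- Everything is checked coordinatewise: each coordinate of either map is a projection followed by
  -- `point` or `principal`.
  inverseLimit-Ult-homeomorphism : Homeomorphism UltLim DiscLim
  inverseLimit-Ult-homeomorphism = record
    { inverse = record
      { to        = to
      ; from      = from
      ; to-cong   = λ {u} {v} u≈v k →
          point-unique em (S k) (finite k) (proj₁ u k)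
            (proj₂ (u≈v k) (point-singleton∈ em (S k) (finite k) (proj₁ v k)))
      ; from-cong = λ x≈y k → Func.cong (principalFunc em (S k)) (x≈y k)
      ; inverse   =
          (λ {x} {u} u≈ k → point-unique em (S k) (finite k) (proj₁ u k)
                              (proj₂ (u≈ k) (Setoid.refl (S k))))
        , (λ {u} {x} x≈ k →
            (λ {A} xk∈A → point∈⁻ em (S k) (finite k) (proj₁ u k) A
                            (resp A (x≈ k) xk∈A))
          , (λ {A} A∈uk → resp A (Setoid.sym (S k) (x≈ k))
                            (point∈⁺ em (S k) (finite k) (proj₁ u k) A A∈uk)))
      }
    ; to-continuous   = inverseLimit-continuous {c = c ⊔ suc e} _≤_
        (λ k → discrete (S k)) f UltLim λ k →
        ∘-continuous UltLim (Ult (S k)) (discrete (S k))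
          (point-continuous {c = i ⊔ r ⊔ c} em (S k) (finite k))
          (projection-continuous {c = c} _≤_ (λ k → Ult (S k)) pushforwards k)
    ; from-continuous = inverseLimit-continuous {c = c} _≤_
        (λ k → Ult (S k)) pushforwards DiscLim λ k →
        ∘-continuous DiscLim (discrete (S k)) (Ult (S k))
          (discrete-continuous (S k) (Ult (S k)) (principalFunc em (S k)))
          (projection-continuous {c = c ⊔ suc e} _≤_ (λ k → discrete (S k)) f k)
    }

-- Finiteness of the set of components

module _ (G : Graph ℓ) where

  infiniteComponent-⊆ : (C D : InfiniteComponent G) → ∀ {v} →
                        v ∈ vertices C → v ∈ vertices D → vertices C ⊆ vertices D
  infiniteComponent-⊆ C D v∈C v∈D w∈C =
    let _ , C⊆ , _  = isComponent C
        _ , D⊆ , ⊆D = isComponent D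
    in ⊆D (D⊆ v∈D ◅◅ Star.reverse (Graph.symmetric G) (C⊆ v∈C) ◅◅ C⊆ w∈C)

  module _ (em : ∀ {a} → ExcludedMiddle a) where

    -- A vertex lies in at most one infinite component up to equality, so each vertex adds at most
    -- one entry; it adds none when its component is finite.
    infiniteComponents-meeting :
      (vs : List (V G)) → ∃ λ Cs → ∀ C → Any (_∈ vertices C) vs →
      Any (Setoid._≈_ (infiniteComponents G) C) Cs
    infiniteComponents-meeting [] = [] , λ _ ()
    infiniteComponents-meeting (v ∷ vs)
      with infiniteComponents-meeting vs | em {P = ∃ λ D → v ∈ vertices D}
    ... | Cs , covers | yes (D , v∈D) = D ∷ Cs , λ where
      C (here v∈C)   → here (infiniteComponent-⊆ C D v∈C v∈D , infiniteComponent-⊆ D C v∈D v∈C)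
      C (there vs∩C) → there (covers C vs∩C)
    ... | Cs , covers | no ∄D = Cs , λ where
      C (here v∈C)   → contradiction (C , v∈C) ∄D
      C (there vs∩C) → covers C vs∩C

    -- A component is closed under reachability, so along with its root it contains a vertex of
    -- `vs`.
    infiniteComponents-finite :
      (vs : List (V G)) → (∀ v → ∃ λ w → w ∈ₗ vs × Reachable G v w) →
      Finite (infiniteComponents G)
    infiniteComponents-finite vs reach = let Cs , covers = infiniteComponents-meeting vs in
      Cs , λ C →
        let v , _ , ⊆C      = isComponent C
            w , w∈vs , v⇝w = reach v
        in covers C (lose w∈vs (⊆C v⇝w))

module _ (em : ∀ {a} → ExcludedMiddle a) (G : Graph ℓ) (F : FiniteEdgeSet G) where

  ends : List (V G)
  ends = map src F ++ map tgt F

  -- Induction on the walk: a first edge outside `F` is kept, while a first edge in `F` makes `v`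
  -- itself an end, reached by the empty walk.
  reach-ends : ∀ {v₀ v} → Reachable G v v₀ → ∃ λ w → w ∈ₗ v₀ ∷ ends × Reachable (G ∖ F) v w
  reach-ends ε = _ , here refl , ε
  reach-ends (vx ◅ x⇝v₀) with em {P = Any (Setoid._≈_ (edgeSetoid G) (edge vx)) F}
  ... | no vx∉F = let w , w∈ , x⇝w = reach-ends x⇝v₀ in w , w∈ , (vx , vx∉F) ◅ x⇝w
  -- Edges are unordered, so `v` may be the source or the target of the matching entry of `F`.
  ... | yes vx∈F with find vx∈F
  ...   | _ , f∈F , inj₁ (refl , _) = _ , there (∈-++⁺ˡ (∈-map⁺ src f∈F)) , ε
  ...   | _ , f∈F , inj₂ (refl , _) = _ , there (∈-++⁺ʳ (map src F) (∈-map⁺ tgt f∈F)) , ε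

  𝒮ᴱ-finite : Connected G → Finite (𝒮ᴱ G F)
  𝒮ᴱ-finite connected with em {P = V G}
  ... | yes v₀ = infiniteComponents-finite (G ∖ F) em (v₀ ∷ ends)
                   λ v → reach-ends (connected v v₀)
  -- The empty graph counts as connected; any component would supply a vertex as its root.
  ... | no ∄v  = [] , λ C → contradiction (proj₁ (isComponent C)) ∄v

proposition9 : (∀ {a} → ExcludedMiddle a) → ∀ {ℓ} (G : Graph ℓ) → Connected G → Homeomorphism (Θᴱ G) (𝒟ᴱ G)
proposition9 em {ℓ} G connected =
  -- Connectedness enters through the finiteness of each `𝒮ᴱ G F`. The level `c` is absorbed by
  -- `suc ℓ`, so `ℓ` is just a filler.
  inverseLimit-Ult-homeomorphism {c = ℓ} em _⊆ᴱ_ (𝒮ᴱ G)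
    (λ F → 𝒮ᴱ-finite em G F connected) (transition G)
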